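{- Let $D$ be a positive integer and let $H$ be a multigraph (loopless, parallel edges allowed) with $\Delta(H)\le D$. Suppose that each edge of $H$ shares at least one endpoint with all but at most $D-2$ of the other edges of $H$. Then $|E(H)|\le \frac52 D$.
   Context: Degrees in a multigraph count edges with multiplicity. -}

module Defs where

open import Data.Fin using (Fin)
open import Data.Fin.Properties using (_≟_; any?)
open import Data.List using (List; length; filter; map; allFin)
open import Data.List.Extrema.Nat using (max)
open import Data.Nat using (ℕ)
open import Data.Product using (_×_; proj₁; proj₂; ∃-syntax)
open import Data.Sum using (_⊎_)
open import Relation.Binary.PropositionalEquality using (_≡_; _≢_)
open import Relation.Nullary using (Dec; ¬?; _×-dec_; _⊎-dec_)

-- Finite loopless multigraphs. Edges are labelled, so distinct edges may have
-- the same ends; the order of the two ends of an edge is never used.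
record Multigraph : Set where
  field
    ∣V∣ ∣E∣  : ℕ
    ends     : Fin ∣E∣ → Fin ∣V∣ × Fin ∣V∣
    loopless : ∀ e → proj₁ (ends e) ≢ proj₂ (ends e)

  Vertex Edge : Set
  Vertex = Fin ∣V∣
  Edge   = Fin ∣E∣

  _IsEndOf_ : Vertex → Edge → Set
  v IsEndOf e = v ≡ proj₁ (ends e) ⊎ v ≡ proj₂ (ends e)

  _isEndOf?_ : ∀ v e → Dec (v IsEndOf e)
  v isEndOf? e = (v ≟ proj₁ (ends e)) ⊎-dec (v ≟ proj₂ (ends e))

  -- There are no loops, so each incident edge contributes exactly 1.
  degree : Vertex → ℕ
  degree v = length (filter (v isEndOf?_) (allFin ∣E∣))

  Δ : ℕ
  Δ = max 0 (map degree (allFin ∣V∣))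

  ShareEnd : Edge → Edge → Set
  ShareEnd e f = ∃[ v ] (v IsEndOf e × v IsEndOf f)

  shareEnd? : ∀ e f → Dec (ShareEnd e f)
  shareEnd? e f = any? λ v → (v isEndOf? e) ×-dec (v isEndOf? f)

  othersDisjointFrom : Edge → List Edge
  othersDisjointFrom e =
    filter (λ f → ¬? (f ≟ e) ×-dec ¬? (shareEnd? e f)) (allFin ∣E∣)

{-# OPTIONS --safe #-}

-- Suppose 2m > 5D. Let v be a vertex of minimum positive degree d, with k
-- neighbours and r further vertices of positive degree. An edge uv yields
-- m + 2 + μ(uv) ≤ d(u) + d(v) + D; summed over the neighbours u of v this is
-- k (m + 2) + d ≤ S + k (d + D), where S is the sum of the neighbours' degrees.
-- Together with the handshake lemma, k d ≤ S ≤ k D and the minimality of d, it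
-- forces k ≥ 3 and k + r = 5, and each of (k , r) = (3 , 2), (4 , 1), (5 , 0)
-- gives 2m ≤ 5D.
module Submission where

open import Defs
open import Data.Bool using (true; false; if_then_else_)
open import Data.Empty using (⊥; ⊥-elim)
open import Data.Fin using (Fin; zero; suc; fromℕ<)
open import Data.Fin.Properties using (any?) renaming (_≟_ to _≟ᶠ_)
open import Data.List using (List; []; _∷_; length; filter; tabulate; allFin)
open import Data.List.Extrema.Nat using (argmin; argmin-all; f[argmin]≤f[xs]; xs≤max)
open import Data.List.Membership.Propositional.Properties using (∈-allFin; ∈-filter⁺; ∈-map⁺)
open import Data.List.Relation.Unary.All using (lookup)
open import Data.List.Relation.Unary.All.Properties using (all-filter)
open import Data.Nat using (ℕ; zero; suc; _+_; _*_; _≤_; _<_; _≤?_; z≤n; s≤s)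
open import Data.Nat.Properties
open import Data.Nat.Tactic.RingSolver using (solve)
open import Data.Product using (_×_; _,_; proj₁; proj₂; ∃-syntax)
open import Data.Sum using (_⊎_; inj₁; inj₂)
open import Relation.Binary.PropositionalEquality
  using (_≡_; _≢_; refl; sym; trans; cong; cong₂; subst; module ≡-Reasoning)
open import Relation.Nullary using (Dec; yes; no; does; _because_; ¬_; ¬?; _×-dec_; _⊎-dec_)
open import Relation.Unary using (Pred; Decidable)
open import Algebra.Properties.Semiring.Sum +-*-semiring
  using (sum; sum-syntax; sum-cong-≗; ∑-distrib-+; ∑-comm; *-distribˡ-sum; *-distribʳ-sum)

-- Arithmetic contradiction between local degree counts.

infixl 6 _⊕_
infixl 7 _⊛_

_⊕_ : ∀ {a b c d} → a ≤ b → c ≤ d → a + c ≤ b + d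
_⊕_ = +-mono-≤

_⊛_ : ∀ {a b} c → a ≤ b → c * a ≤ c * b
c ⊛ p = *-monoʳ-≤ c p

1*x+0≡x : ∀ x → 1 * x + 0 ≡ x
1*x+0≡x x = trans (+-identityʳ (1 * x)) (*-identityˡ x)

exceeds : ∀ {a b} z → a ≤ b → a ≡ b + suc z → ⊥
exceeds {b = b} z a≤b a≡b+1+z = m+1+n≰m b (subst (_≤ b) a≡b+1+z a≤b)

-- Every contradiction below is a nonnegative combination of the hypotheses
-- whose left-hand side exceeds its right-hand side by 1 + z.
module _ {m D d S : ℕ} (large : 1 + 5 * D ≤ 2 * m) (d≤D : d ≤ D) (0<d : 1 ≤ d) where

  -- `k` and `r` count the neighbours of the minimum-degree vertex and the further non-isolated
  -- vertices. The last two inequalities come from the handshake lemma, with each of the `r` degrees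
  -- replaced by `d` and by `D` respectively.
  local-degrees-incompatible : ∀ k r →
    k * (m + 2) + d ≤ S + k * (d + D) → S ≤ k * D → k * d ≤ S →
    S + d + r * d ≤ 2 * m → 2 * m ≤ S + d + r * D → ⊥
  local-degrees-incompatible 0 r b c e lo hi =
    exceeds 0 (b ⊕ c ⊕ 0<d) (solve (m ∷ D ∷ d ∷ S ∷ []))
  local-degrees-incompatible 1 r b c e lo hi =
    exceeds (4 + D) (2 ⊛ (b ⊕ c) ⊕ large) (solve (m ∷ D ∷ d ∷ S ∷ []))
  -- Here `2 * m + 4 ≤ 4 * D + d`, which is at most `5 * D`.
  local-degrees-incompatible 2 r b c e lo hi =
    exceeds 4 (b ⊕ c ⊕ large ⊕ d≤D) (solve (m ∷ D ∷ d ∷ S ∷ []))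
  local-degrees-incompatible k@(suc (suc (suc j))) r b c e lo hi =
    final j r (≤-antisym (≮⇒≥ not-above) (≮⇒≥ not-below)) b e lo
    where
    -- `b` and `c` give `k * (m + 2) + d ≤ k * (2 * D + d)`; positivity of `d` makes the comparison
    -- strict.
    degree-sum : m + 2 < 2 * D + d
    degree-sum = ≰⇒> λ (p : 2 * D + d ≤ m + 2) →
      exceeds 0 (b ⊕ c ⊕ 0<d ⊕ k ⊛ p) (solve (m ∷ D ∷ d ∷ S ∷ j ∷ []))

    D+7≤2d : D + 7 ≤ 2 * d
    D+7≤2d = ≮⇒≥ λ (p : 2 * d < D + 7) →
      exceeds 0 (large ⊕ 2 ⊛ degree-sum ⊕ p) (solve (m ∷ D ∷ d ∷ []))

    -- Eliminating `S` from `b` and `lo`, then using `large` and `D+7≤2d`, leaves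
    -- `(j + r) * D < 3 * D`.
    not-above : 2 < j + r → ⊥
    not-above p = exceeds (12 + 5 * j + 7 * r)
      (2 ⊛ (b ⊕ lo ⊕ (1 + j) ⊛ d≤D) ⊕ (1 + j) ⊛ large ⊕ r ⊛ D+7≤2d ⊕ D ⊛ p)
      (solve (m ∷ D ∷ d ∷ S ∷ j ∷ r ∷ []))

    -- `hi` and `c` give `2 * m ≤ (4 + j + r) * D`, at most `5 * D` when `j + r ≤ 1`.
    not-below : j + r < 2 → ⊥
    not-below p = exceeds 0 (large ⊕ hi ⊕ c ⊕ d≤D ⊕ D ⊛ p)
      (solve (m ∷ D ∷ d ∷ S ∷ j ∷ r ∷ []))

    final : ∀ j r → j + r ≡ 2 →
      (3 + j) * (m + 2) + d ≤ S + (3 + j) * (d + D) → (3 + j) * d ≤ S →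
      S + d + r * d ≤ 2 * m → ⊥
    -- `b` and `lo` give `m + 6 + d ≤ 3 * D`, hence `2 * d < D`, against `D+7≤2d`.
    final 0 .2 refl b e lo =
      exceeds 19 (2 ⊛ (b ⊕ lo) ⊕ large ⊕ D+7≤2d) (solve (m ∷ D ∷ d ∷ S ∷ []))
    final 1 .1 refl b e lo =
      exceeds 8 (b ⊕ lo ⊕ large ⊕ d≤D) (solve (m ∷ D ∷ d ∷ S ∷ []))
    -- `b` and `lo` give `3 * m + 10 ≤ 3 * d + 5 * D`; here `d` is bounded by `6 * d ≤ 2 * m`, the
    -- degree count over six vertices.
    final 2 .0 refl b e lo =
      exceeds 21 (2 ⊛ (b ⊕ lo) ⊕ (lo ⊕ e) ⊕ 2 ⊛ large) (solve (m ∷ D ∷ d ∷ S ∷ []))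
    final (suc (suc (suc j))) r ()

-- Indicators and finite sums.

𝟙 : ∀ {p} {P : Set p} → Dec P → ℕ
𝟙 P? = if does P? then 1 else 0

𝟙-yes : ∀ {p} {P : Set p} (P? : Dec P) → P → 𝟙 P? ≡ 1
𝟙-yes (yes _) p = refl
𝟙-yes (no ¬p) p = ⊥-elim (¬p p)

𝟙-no : ∀ {p} {P : Set p} (P? : Dec P) → ¬ P → 𝟙 P? ≡ 0
𝟙-no (yes p) ¬p = ⊥-elim (¬p p)
𝟙-no (no _)  ¬p = refl

𝟙≤1 : ∀ {p} {P : Set p} (P? : Dec P) → 𝟙 P? ≤ 1
𝟙≤1 (yes _) = ≤-refl
𝟙≤1 (no _)  = z≤n

𝟙-exclusive : ∀ {p q} {P : Set p} {Q : Set q} (P? : Dec P) (Q? : Dec Q) → ¬ (P × Q) → 𝟙 P? * 𝟙 Q? ≡ 0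
𝟙-exclusive (yes p) (yes q) ¬pq = ⊥-elim (¬pq (p , q))
𝟙-exclusive (yes _) (no _)  ¬pq = refl
𝟙-exclusive (no _)  _       ¬pq = refl

𝟙-⊎ : ∀ {p q} {P : Set p} {Q : Set q} (P? : Dec P) (Q? : Dec Q) → ¬ (P × Q) →
  𝟙 (P? ⊎-dec Q?) ≡ 𝟙 P? + 𝟙 Q?
𝟙-⊎ (yes p) (yes q) ¬pq = ⊥-elim (¬pq (p , q))
𝟙-⊎ (yes _) (no _)  ¬pq = refl
𝟙-⊎ (no _)  (yes _) ¬pq = refl
𝟙-⊎ (no _)  (no _)  ¬pq = refl

-- Inclusion-exclusion for `P` and `Q`, with `R` covering the complement of their union. The product
-- stands on the left to avoid truncated subtraction.
𝟙-cover : ∀ {p q r} {P : Set p} {Q : Set q} {R : Set r}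
  (P? : Dec P) (Q? : Dec Q) (R? : Dec R) → (¬ P → ¬ Q → R) →
  1 + 𝟙 P? * 𝟙 Q? ≤ 𝟙 P? + 𝟙 Q? + 𝟙 R?
𝟙-cover (yes _) (yes _) R? cover = s≤s (s≤s z≤n)
𝟙-cover (yes _) (no _)  R? cover = s≤s z≤n
𝟙-cover (no _)  (yes _) R? cover = s≤s z≤n
𝟙-cover (no ¬p) (no ¬q) R? cover = ≤-reflexive (sym (𝟙-yes R? (cover ¬p ¬q)))

𝟙-idem : ∀ {p} {P : Set p} (P? : Dec P) → 𝟙 P? * 𝟙 P? ≡ 𝟙 P?
𝟙-idem (yes _) = refl
𝟙-idem (no _)  = refl

length-filter-tabulate : ∀ {a p} {A : Set a} {P : Pred A p} (P? : Decidable P) {n} (f : Fin n → A) →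
  length (filter P? (tabulate f)) ≡ ∑[ i < n ] 𝟙 (P? (f i))
length-filter-tabulate P? {zero}  f = refl
length-filter-tabulate P? {suc n} f with P? (f zero)
... | true  because _ = cong suc (length-filter-tabulate P? (λ i → f (suc i)))
... | false because _ = length-filter-tabulate P? (λ i → f (suc i))

sum-mono-≤ : ∀ {n} {f g : Fin n → ℕ} → (∀ i → f i ≤ g i) → sum f ≤ sum g
sum-mono-≤ {zero}  f≤g = z≤n
sum-mono-≤ {suc n} f≤g = +-mono-≤ (f≤g zero) (sum-mono-≤ (λ i → f≤g (suc i)))

term≤sum : ∀ {n} (f : Fin n → ℕ) i → f i ≤ sum f
term≤sum f zero    = m≤m+n _ _
term≤sum f (suc i) = m≤n⇒m≤o+n _ (term≤sum (λ j → f (suc j)) i)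

sum-const : ∀ n c → ∑[ i < n ] c ≡ n * c
sum-const zero    c = refl
sum-const (suc n) c = cong (c +_) (sum-const n c)

sum-𝟙≟ : ∀ {n} (a : Fin n) → ∑[ i < n ] 𝟙 (i ≟ᶠ a) ≡ 1
sum-𝟙≟ {suc n} zero    = cong suc (trans (sum-const n 0) (*-zeroʳ n))
-- The head term computes to 0, and `suc i ≟ᶠ suc a` has the same `does` as `i ≟ᶠ a`.
sum-𝟙≟ {suc n} (suc a) = sum-𝟙≟ a

sum-affine : ∀ {n} (f g h : Fin n → ℕ) x y →
  ∑[ i < n ] (f i + g i * x + h i * y) ≡ sum f + sum g * x + sum h * y
sum-affine {n} f g h x y = begin
  ∑[ i < n ] (f i + g i * x + h i * y)
    ≡⟨ ∑-distrib-+ (λ i → f i + g i * x) (λ i → h i * y) ⟩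
  ∑[ i < n ] (f i + g i * x) + ∑[ i < n ] (h i * y)
    ≡⟨ cong₂ _+_ (∑-distrib-+ f (λ i → g i * x)) (sym (*-distribʳ-sum y h)) ⟩
  sum f + ∑[ i < n ] (g i * x) + sum h * y
    ≡⟨ cong (λ z → sum f + z + sum h * y) (*-distribʳ-sum x g) ⟨
  sum f + sum g * x + sum h * y ∎
  where open ≡-Reasoning

-- Double counting of vertex-edge incidences.

module Incidence (H : Multigraph) where

  open Multigraph H

  inc : Vertex → Edge → ℕ
  inc v e = 𝟙 (v isEndOf? e)

  -- The multiplicity of uv when u ≢ v, but the degree of v when u ≡ v.
  codegree : Vertex → Vertex → ℕ
  codegree u v = ∑[ e < ∣E∣ ] (inc u e * inc v e)

  degree≡ : ∀ v → degree v ≡ ∑[ e < ∣E∣ ] inc v e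
  degree≡ v = length-filter-tabulate (v isEndOf?_) (λ e → e)

  codegree-self : ∀ v → codegree v v ≡ degree v
  codegree-self v = trans (sum-cong-≗ λ e → 𝟙-idem (v isEndOf? e)) (sym (degree≡ v))

  codegree≤degree : ∀ u v → codegree u v ≤ degree u
  codegree≤degree u v = subst (codegree u v ≤_) (sym (degree≡ u)) (sum-mono-≤ bound)
    where
    bound : ∀ e → inc u e * inc v e ≤ inc u e
    bound e = ≤-trans (*-monoʳ-≤ (inc u e) (𝟙≤1 (v isEndOf? e))) (≤-reflexive (*-identityʳ (inc u e)))

  two-ends : ∀ e → ∑[ v < ∣V∣ ] inc v e ≡ 2
  two-ends e = begin
    ∑[ v < ∣V∣ ] inc v e
      ≡⟨ sum-cong-≗ (λ v → 𝟙-⊎ (v ≟ᶠ a) (v ≟ᶠ b) λ (p , q) → loopless e (trans (sym p) q)) ⟩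
    ∑[ v < ∣V∣ ] (𝟙 (v ≟ᶠ a) + 𝟙 (v ≟ᶠ b))
      ≡⟨ ∑-distrib-+ (λ v → 𝟙 (v ≟ᶠ a)) (λ v → 𝟙 (v ≟ᶠ b)) ⟩
    ∑[ v < ∣V∣ ] 𝟙 (v ≟ᶠ a) + ∑[ v < ∣V∣ ] 𝟙 (v ≟ᶠ b)
      ≡⟨ cong₂ _+_ (sum-𝟙≟ a) (sum-𝟙≟ b) ⟩
    2 ∎
    where
    open ≡-Reasoning
    a b : Vertex
    a = proj₁ (ends e)
    b = proj₂ (ends e)

  handshake : ∑[ v < ∣V∣ ] degree v ≡ 2 * ∣E∣
  handshake = begin
    ∑[ v < ∣V∣ ] degree v              ≡⟨ sum-cong-≗ degree≡ ⟩
    ∑[ v < ∣V∣ ] ∑[ e < ∣E∣ ] inc v e      ≡⟨ ∑-comm {∣V∣} {∣E∣} inc ⟩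
    ∑[ e < ∣E∣ ] ∑[ v < ∣V∣ ] inc v e      ≡⟨ sum-cong-≗ two-ends ⟩
    ∑[ e < ∣E∣ ] 2                     ≡⟨ sum-const ∣E∣ 2 ⟩
    ∣E∣ * 2                            ≡⟨ *-comm ∣E∣ 2 ⟩
    2 * ∣E∣                            ∎
    where open ≡-Reasoning

  -- Each edge at `v` is counted once per end: half of the total is the diagonal term `u = v`, the
  -- other half the multiplicities.
  sum-codegree : ∀ v → ∑[ u < ∣V∣ ] codegree u v ≡ 2 * degree v
  sum-codegree v = begin
    ∑[ u < ∣V∣ ] ∑[ e < ∣E∣ ] (inc u e * inc v e)    ≡⟨ ∑-comm {∣V∣} {∣E∣} (λ u e → inc u e * inc v e) ⟩
    ∑[ e < ∣E∣ ] ∑[ u < ∣V∣ ] (inc u e * inc v e)    ≡⟨ sum-cong-≗ (λ e → sym (*-distribʳ-sum (inc v e) (λ u → inc u e))) ⟩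
    ∑[ e < ∣E∣ ] ((∑[ u < ∣V∣ ] inc u e) * inc v e)  ≡⟨ sum-cong-≗ (λ e → cong (_* inc v e) (two-ends e)) ⟩
    ∑[ e < ∣E∣ ] (2 * inc v e)                       ≡⟨ *-distribˡ-sum 2 (inc v) ⟨
    2 * (∑[ e < ∣E∣ ] inc v e)                       ≡⟨ cong (2 *_) (degree≡ v) ⟨
    2 * degree v                                     ∎
    where open ≡-Reasoning

  disjointFrom≡ : ∀ e → length (othersDisjointFrom e)
    ≡ ∑[ f < ∣E∣ ] 𝟙 (¬? (f ≟ᶠ e) ×-dec ¬? (shareEnd? e f))
  disjointFrom≡ e = length-filter-tabulate (λ f → ¬? (f ≟ᶠ e) ×-dec ¬? (shareEnd? e f)) (λ f → f)

  ends-cover : ∀ {u v w e} → u ≢ v → u IsEndOf e → v IsEndOf e → w IsEndOf e → w ≡ u ⊎ w ≡ v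
  ends-cover u≢v (inj₁ u≡) (inj₁ v≡) _         = ⊥-elim (u≢v (trans u≡ (sym v≡)))
  ends-cover u≢v (inj₂ u≡) (inj₂ v≡) _         = ⊥-elim (u≢v (trans u≡ (sym v≡)))
  ends-cover u≢v (inj₁ u≡) (inj₂ v≡) (inj₁ w≡) = inj₁ (trans w≡ (sym u≡))
  ends-cover u≢v (inj₁ u≡) (inj₂ v≡) (inj₂ w≡) = inj₂ (trans w≡ (sym v≡))
  ends-cover u≢v (inj₂ u≡) (inj₁ v≡) (inj₁ w≡) = inj₂ (trans w≡ (sym v≡))
  ends-cover u≢v (inj₂ u≡) (inj₁ v≡) (inj₂ w≡) = inj₁ (trans w≡ (sym u≡))

  -- Every edge meets `u`, meets `v`, or is disjoint from `e`; the edges joining `u` and `v` are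
  -- counted in both degrees.
  edge-bound : ∀ {u v e} → u ≢ v → u IsEndOf e → v IsEndOf e →
    ∣E∣ + codegree u v ≤ degree u + degree v + length (othersDisjointFrom e)
  edge-bound {u} {v} {e} u≢v u∈e v∈e = begin
    ∣E∣ + codegree u v
      ≡⟨ cong (_+ codegree u v) (trans (sym (*-identityʳ ∣E∣)) (sym (sum-const ∣E∣ 1))) ⟩
    ∑[ f < ∣E∣ ] 1 + codegree u v
      ≡⟨ ∑-distrib-+ (λ _ → 1) (λ f → inc u f * inc v f) ⟨
    ∑[ f < ∣E∣ ] (1 + inc u f * inc v f)
      ≤⟨ sum-mono-≤ pointwise ⟩
    ∑[ f < ∣E∣ ] (inc u f + inc v f + disj f)
      ≡⟨ ∑-distrib-+ (λ f → inc u f + inc v f) disj ⟩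
    ∑[ f < ∣E∣ ] (inc u f + inc v f) + sum disj
      ≡⟨ cong (_+ sum disj) (∑-distrib-+ (inc u) (inc v)) ⟩
    sum (inc u) + sum (inc v) + sum disj
      ≡⟨ cong₂ _+_ (cong₂ _+_ (degree≡ u) (degree≡ v)) (disjointFrom≡ e) ⟨
    degree u + degree v + length (othersDisjointFrom e) ∎
    where
    open ≤-Reasoning
    disj : Edge → ℕ
    disj f = 𝟙 (¬? (f ≟ᶠ e) ×-dec ¬? (shareEnd? e f))
    pointwise : ∀ f → 1 + inc u f * inc v f ≤ inc u f + inc v f + disj f
    pointwise f = 𝟙-cover (u isEndOf? f) (v isEndOf? f) (¬? (f ≟ᶠ e) ×-dec ¬? (shareEnd? e f))
      -- An edge avoiding `u` differs from `e`, which contains `u`.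
      λ u∉f v∉f → (λ { refl → u∉f u∈e }) , not-sharing u∉f v∉f
      where
      not-sharing : ¬ u IsEndOf f → ¬ v IsEndOf f → ¬ ShareEnd e f
      not-sharing u∉f v∉f (w , w∈e , w∈f) with ends-cover {e = e} u≢v u∈e v∈e w∈e
      ... | inj₁ refl = u∉f w∈f
      ... | inj₂ refl = v∉f w∈f

  degree≤Δ : ∀ v → degree v ≤ Δ
  degree≤Δ v = lookup (xs≤max 0 _) (∈-map⁺ degree (∈-allFin v))

  end-degree : ∀ {v e} → v IsEndOf e → 1 ≤ degree v
  end-degree {v} {e} v∈e = begin
    1            ≡⟨ 𝟙-yes (v isEndOf? e) v∈e ⟨
    inc v e      ≤⟨ term≤sum (inc v) e ⟩
    sum (inc v)  ≡⟨ degree≡ v ⟨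
    degree v     ∎
    where open ≤-Reasoning

  -- Minimum positive degree and the positions of vertices relative to it.

  min-positive-degree : ∀ v₀ → 1 ≤ degree v₀ →
    ∃[ v ] 1 ≤ degree v × (∀ w → 1 ≤ degree w → degree v ≤ degree w)
  -- `argmin` may return its default, so `v₀` must have positive degree too.
  min-positive-degree v₀ 0<d₀ = argmin degree v₀ candidates
    , argmin-all degree 0<d₀ (all-filter positive? (allFin ∣V∣))
    , λ w 0<d → lookup (f[argmin]≤f[xs] v₀ candidates) (∈-filter⁺ positive? (∈-allFin w) 0<d)
    where
    positive? : Decidable (λ w → 1 ≤ degree w)
    positive? w = 1 ≤? degree w
    candidates : List Vertex
    candidates = filter positive? (allFin ∣V∣)

  -- Each constructor carries the evidence that the pointwise estimates use. Isolated vertices are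
  -- kept apart because minimality among positive degrees says nothing about them.
  data Position (v w : Vertex) : Set where
    self      : w ≡ v → Position v w
    neighbour : ∀ e → w ≢ v → w IsEndOf e → v IsEndOf e → Position v w
    far       : w ≢ v → codegree w v ≡ 0 → 1 ≤ degree w → Position v w
    isolated  : w ≢ v → degree w ≡ 0 → Position v w

  codegree-0 : ∀ u v → (∀ e → ¬ (u IsEndOf e × v IsEndOf e)) → codegree u v ≡ 0
  codegree-0 u v ¬common = trans (sum-cong-≗ λ e → 𝟙-exclusive (u isEndOf? e) (v isEndOf? e) (¬common e))
    (trans (sum-const ∣E∣ 0) (*-zeroʳ ∣E∣))

  position : ∀ v w → Position v w
  position v w with w ≟ᶠ v | any? (λ e → (w isEndOf? e) ×-dec (v isEndOf? e)) | 1 ≤? degree w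
  ... | yes w≡v | _                       | _     = self w≡v
  ... | no  w≢v | yes (e , w∈e , v∈e)   | _     = neighbour e w≢v w∈e v∈e
  ... | no  w≢v | no ¬common              | yes p = far w≢v (codegree-0 w v λ e p → ¬common (e , p)) p
  ... | no  w≢v | no _                    | no ¬p = isolated w≢v (n<1⇒n≡0 (≰⇒> ¬p))

  module _ {v w : Vertex} where

    isSelf isNeighbour isFar : Position v w → ℕ
    isSelf (self _) = 1
    isSelf _        = 0
    isNeighbour (neighbour _ _ _ _) = 1
    isNeighbour _                   = 0
    isFar (far _ _ _) = 1
    isFar _           = 0

    isSelf≡ : ∀ p → isSelf p ≡ 𝟙 (w ≟ᶠ v)
    isSelf≡ (self w≡v)            = sym (𝟙-yes (w ≟ᶠ v) w≡v)
    isSelf≡ (neighbour _ w≢v _ _) = sym (𝟙-no (w ≟ᶠ v) w≢v)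
    isSelf≡ (far w≢v _ _)         = sym (𝟙-no (w ≟ᶠ v) w≢v)
    isSelf≡ (isolated w≢v _)      = sym (𝟙-no (w ≟ᶠ v) w≢v)

  -- Degree counts around the chosen vertex.

  module MinimumDegree (D : ℕ) (Δ≤D : Δ ≤ D)
    (few-disjoint : ∀ e → length (othersDisjointFrom e) + 2 ≤ D)
    (v : Vertex) (minimal : ∀ w → 1 ≤ degree w → degree v ≤ degree w) where

    -- `N` ignores multiplicity, so its sum `k` counts distinct neighbours.
    I N F S′ : Vertex → ℕ
    I w  = isSelf (position v w)
    N w  = isNeighbour (position v w)
    F w  = isFar (position v w)
    S′ w = N w * degree w

    d k r S : ℕ
    d = degree v
    k = sum N
    r = sum F
    S = sum S′

    degree≤D : ∀ w → degree w ≤ D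
    degree≤D w = ≤-trans (degree≤Δ w) Δ≤D

    sum-self : sum I ≡ 1
    sum-self = trans (sum-cong-≗ λ w → isSelf≡ (position v w)) (sum-𝟙≟ v)

    sum-affine-self : ∀ h y → ∑[ w < ∣V∣ ] (S′ w + I w * d + h w * y) ≡ S + d + sum h * y
    sum-affine-self h y = trans (sum-affine S′ I h d y)
      (cong (λ i → S + i + sum h * y) (trans (cong (_* d) sum-self) (*-identityˡ d)))

    S≤kD : S ≤ k * D
    S≤kD = ≤-trans (sum-mono-≤ λ w → *-monoʳ-≤ (N w) (degree≤D w)) (≤-reflexive (sym (*-distribʳ-sum D N)))

    kd≤S : k * d ≤ S
    kd≤S = ≤-trans (≤-reflexive (*-distribʳ-sum d N)) (sum-mono-≤ λ w → pointwise (position v w))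
      where
      pointwise : ∀ {w} (p : Position v w) → isNeighbour p * d ≤ isNeighbour p * degree w
      pointwise {w} (neighbour e _ w∈e _) = *-monoʳ-≤ 1 (minimal w (end-degree {e = e} w∈e))
      pointwise (self _)       = z≤n
      pointwise (far _ _ _)    = z≤n
      pointwise (isolated _ _) = z≤n

    -- In the handshake sum, neighbours and `v` enter exactly, and minimality gives each far vertex
    -- at least `d`.
    edges-lower : S + d + r * d ≤ 2 * ∣E∣
    edges-lower = begin
      S + d + r * d                               ≡⟨ sum-affine-self F d ⟨
      ∑[ w < ∣V∣ ] (S′ w + I w * d + F w * d)     ≤⟨ sum-mono-≤ (λ w → pointwise (position v w)) ⟩
      ∑[ w < ∣V∣ ] degree w                       ≡⟨ handshake ⟩
      2 * ∣E∣                                     ∎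
      where
      open ≤-Reasoning
      pointwise : ∀ {w} (p : Position v w) →
        isNeighbour p * degree w + isSelf p * d + isFar p * d ≤ degree w
      pointwise (self refl)               = ≤-reflexive (1*x+0≡x d)
      pointwise {w} (neighbour _ _ _ _)   = ≤-reflexive (trans (+-identityʳ _) (1*x+0≡x (degree w)))
      pointwise {w} (far _ _ 0<deg)       = ≤-trans (≤-reflexive (*-identityˡ d)) (minimal w 0<deg)
      pointwise (isolated _ _)            = z≤n

    edges-upper : 2 * ∣E∣ ≤ S + d + r * D
    edges-upper = begin
      2 * ∣E∣                                     ≡⟨ handshake ⟨
      ∑[ w < ∣V∣ ] degree w                       ≤⟨ sum-mono-≤ (λ w → pointwise (position v w)) ⟩
      ∑[ w < ∣V∣ ] (S′ w + I w * d + F w * D)     ≡⟨ sum-affine-self F D ⟩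
      S + d + r * D                               ∎
      where
      open ≤-Reasoning
      pointwise : ∀ {w} (p : Position v w) →
        degree w ≤ isNeighbour p * degree w + isSelf p * d + isFar p * D
      pointwise (self refl)             = ≤-reflexive (sym (1*x+0≡x d))
      pointwise {w} (neighbour _ _ _ _) = ≤-reflexive (sym (trans (+-identityʳ _) (1*x+0≡x (degree w))))
      pointwise {w} (far _ _ _)         = ≤-trans (degree≤D w) (≤-reflexive (sym (*-identityˡ D)))
      pointwise (isolated _ deg≡0)      = ≤-trans (≤-reflexive deg≡0) z≤n

    -- `edge-bound` is summed over one edge to each neighbour; the multiplicities at `v` add up to
    -- `d`.
    neighbourhood-bound : k * (∣E∣ + 2) + d ≤ S + k * (d + D)
    -- The extra `d` is the diagonal term `codegree v v`, which allows the codegrees to be summed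
    -- over all vertices.
    neighbourhood-bound = +-cancelʳ-≤ d _ _ (begin
      k * (∣E∣ + 2) + d + d
        ≡⟨ trans (+-assoc (k * (∣E∣ + 2)) d d) (cong (λ z → k * (∣E∣ + 2) + (d + z)) (sym (+-identityʳ d))) ⟩
      k * (∣E∣ + 2) + 2 * d
        ≡⟨ cong₂ _+_ (*-distribʳ-sum (∣E∣ + 2) N) (sym (sum-codegree v)) ⟩
      ∑[ w < ∣V∣ ] (N w * (∣E∣ + 2)) + ∑[ w < ∣V∣ ] codegree w v
        ≡⟨ ∑-distrib-+ (λ w → N w * (∣E∣ + 2)) (λ w → codegree w v) ⟨
      ∑[ w < ∣V∣ ] (N w * (∣E∣ + 2) + codegree w v)
        ≤⟨ sum-mono-≤ (λ w → pointwise (position v w)) ⟩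
      ∑[ w < ∣V∣ ] (S′ w + I w * d + N w * (d + D))
        ≡⟨ sum-affine-self N (d + D) ⟩
      S + d + k * (d + D)
        ≡⟨ trans (+-assoc S d _) (trans (cong (S +_) (+-comm d _)) (sym (+-assoc S _ d))) ⟩
      S + k * (d + D) + d ∎)
      where
      open ≤-Reasoning
      -- `δ` is the number of edges disjoint from the chosen one. The factors `1` and the summand
      -- `0` are the indicators of a neighbour after reduction.
      rearrange : ∀ m c x y {δ} → m + c ≤ x + y + δ → δ + 2 ≤ D →
        1 * (m + 2) + c ≤ 1 * x + 0 + 1 * (y + D)
      rearrange m c x y {δ} p q = +-cancelʳ-≤ δ _ _ (begin
        1 * (m + 2) + c + δ          ≡⟨ solve (m ∷ c ∷ δ ∷ []) ⟩
        (m + c) + (δ + 2)            ≤⟨ p ⊕ q ⟩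
        (x + y + δ) + D              ≡⟨ solve (x ∷ y ∷ δ ∷ D ∷ []) ⟩
        1 * x + 0 + 1 * (y + D) + δ  ∎)
      pointwise : ∀ {w} (p : Position v w) →
        isNeighbour p * (∣E∣ + 2) + codegree w v
          ≤ isNeighbour p * degree w + isSelf p * d + isNeighbour p * (d + D)
      pointwise (self refl) = ≤-reflexive (trans (codegree-self v) (sym (1*x+0≡x d)))
      pointwise {w} (neighbour e w≢v w∈e v∈e) = rearrange ∣E∣ (codegree w v) (degree w) d
        (edge-bound {e = e} w≢v w∈e v∈e) (few-disjoint e)
      pointwise (far _ codeg≡0 _) = ≤-reflexive codeg≡0
      pointwise {w} (isolated _ deg≡0) = ≤-trans (codegree≤degree w v) (≤-reflexive deg≡0)

open Multigraph

-- Adding 2 on the left expresses "at most D - 2" without truncation at `D = 1`.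
theorem4 : (D : ℕ) → 1 ≤ D → (H : Multigraph) → Δ H ≤ D →
    (∀ (e : Edge H) → length (othersDisjointFrom H e) + 2 ≤ D) →
    2 * ∣E∣ H ≤ 5 * D
theorem4 D _ H Δ≤D few-disjoint = ≮⇒≥ contra
  where
  open Incidence H
  contra : 5 * D < 2 * ∣E∣ H → ⊥
  contra large with min-positive-degree (proj₁ (ends H e₀)) (end-degree {e = e₀} (inj₁ refl))
    where
    e₀ : Edge H
    -- `large` makes the number of edges positive, so an edge exists and its ends have positive
    -- degree.
    e₀ = fromℕ< (*-cancelˡ-< 2 0 (∣E∣ H) (≤-trans (s≤s z≤n) large))
  ... | v , 0<d , minimal =
    local-degrees-incompatible large (degree≤D v) 0<d k r neighbourhood-bound S≤kD kd≤S edges-lower edges-upper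
    where open MinimumDegree D Δ≤D few-disjoint v minimal
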